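{- Let $\mathcal{H}=(V,E)$ be a finite hypergraph in which every hyperedge has size at least $2$. Let $\mathcal{H}^{[1]}$ denote its $1$-intersection graph. If $\chi(\mathcal{H}^{[1]})=2$, then $\chi(\mathcal{H})=2$.
   Context: A hypergraph $\mathcal{H}=(V,E)$ consists of a finite vertex set $V$ and a collection $E$ of subsets of $V$ (hyperedges). A vertex coloring of $\mathcal{H}$ is proper if no hyperedge is monochromatic; $\chi(\mathcal{H})$ is the least number of colors in a proper vertex coloring of $\mathcal{H}$ (which exists since all hyperedges have size at least $2$). The $1$-intersection graph $\mathcal{H}^{[1]}$ of $\mathcal{H}$ is the graph whose vertex set is $E(\mathcal{H})$, in which two distinct hyperedges $e,f$ are adjacent if and only if $|e\cap f|=1$. $\chi(\mathcal{H}^{[1]})$ is the usual chromatic number of this graph. -}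

module Defs where

open import Data.Bool using (Bool; T)
open import Data.Fin using (Fin)
open import Data.Fin.Subset using (Subset; _∈_; _∩_; ∣_∣)
open import Data.Fin.Subset.Properties using (∩-comm)
open import Data.Nat using (ℕ; _≤_)
open import Data.Product using (Σ; _×_; _,_; proj₁; ∃)
open import Function using (_∘_)
open import Relation.Binary using (Rel; Symmetric; Irreflexive)
open import Relation.Binary.PropositionalEquality
  using (_≡_; _≢_; refl; sym; trans; cong)
open import Relation.Nullary using (¬_)
open import Relation.Unary using (Pred)
open import Level using (0ℓ)

IsLeast : Pred ℕ 0ℓ → Pred ℕ 0ℓ
IsLeast P k = P k × (∀ j → P j → k ≤ j)

record Graph : Set₁ where
  field
    Vertex : Set
    Adj    : Rel Vertex 0ℓ
    symm   : Symmetric Adj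
    irrefl : Irreflexive _≡_ Adj

module _ (G : Graph) where
  open Graph G

  ProperGraphColouring : ∀ {k} → (Vertex → Fin k) → Set
  ProperGraphColouring c = ∀ u v → Adj u v → c u ≢ c v

  GraphColourable : ℕ → Set
  GraphColourable k = ∃ λ (c : Vertex → Fin k) → ProperGraphColouring c

  -- χ as a relation: "χ(G) = k".
  GraphChromaticNumber : ℕ → Set
  GraphChromaticNumber = IsLeast GraphColourable

-- The vertex set is Fin order.  The hyperedges form a set of subsets, given by
-- its characteristic function, so there are no repeated hyperedges.
record Hypergraph : Set where
  field
    order   : ℕ
    isEdge  : Subset order → Bool

  -- T is proof-irrelevant, so elements of Edge are determined by proj₁.
  Edge : Set
  Edge = Σ (Subset order) (T ∘ isEdge)

module _ (H : Hypergraph) where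
  open Hypergraph H

  Monochromatic : ∀ {k} → (Fin order → Fin k) → Subset order → Set
  Monochromatic c e = ∀ x y → x ∈ e → y ∈ e → c x ≡ c y

  ProperColouring : ∀ {k} → (Fin order → Fin k) → Set
  ProperColouring c = ∀ (e : Edge) → ¬ Monochromatic c (proj₁ e)

  Colourable : ℕ → Set
  Colourable k = ∃ λ (c : Fin order → Fin k) → ProperColouring c

  -- χ as a relation: "χ(H) = k".
  ChromaticNumber : ℕ → Set
  ChromaticNumber = IsLeast Colourable

  EdgesOfSizeAtLeast : ℕ → Set
  EdgesOfSizeAtLeast s = ∀ (e : Edge) → s ≤ ∣ proj₁ e ∣

  1-intersectionGraph : Graph
  1-intersectionGraph = record
    { Vertex = Edge
    ; Adj    = λ e f → e ≢ f × ∣ proj₁ e ∩ proj₁ f ∣ ≡ 1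
    ; symm   = λ {e} {f} (e≢f , meet) →
        e≢f ∘ sym , trans (cong ∣_∣ (∩-comm (proj₁ f) (proj₁ e))) meet
    ; irrefl = λ e≡f (e≢f , _) → e≢f e≡f
    }

-- Let κ : E → Bool properly colour the 1-intersection graph.  Suppose that
-- c₀ : V → Bool takes the colour `not (κ e)` somewhere on every edge e.  An
-- edge e that still misses κ e is then constantly `not (κ e)`; flip one of its
-- vertices v.  An edge g that loses `not (κ g)` by this flip has κ g = κ e and
-- meets e in v only, which is impossible because κ is proper.  So the property
-- survives, and if v is always chosen with c₀ v = not (κ e), then no vertex is
-- flipped twice, and the process ends with a proper colouring.
--
-- Such a c₀ is found by adding the edges one at a time: a proper colouring c
-- of the previous edges serves unless it is constantly κ f on the new edge f,
-- and in that case `not ∘ c` serves.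

module Submission where

open import Defs
open import Data.Bool using (Bool; true; false; not; T?)
open import Data.Bool.Properties using (T-irrelevant; not-involutive; not-injective; ¬-not) renaming (_≟_ to _≟ᵇ_)
open import Data.Fin using (Fin; zero; suc; _≟_)
open import Data.Fin.Properties using (any?; 2↔Bool)
open import Data.Fin.Subset using (Subset; inside; outside; Nonempty; _∈_; _⊂_; _∩_; _-_; ⁅_⁆; ⊤; ∣_∣)
open import Data.Fin.Subset.Induction using (⊂-wellFounded)
open import Data.Fin.Subset.Properties
open import Data.List using (List; []; _∷_; _++_; map)
open import Data.List.Membership.Propositional using (find) renaming (_∈_ to _∈ˡ_)
open import Data.List.Membership.Propositional.Properties using (∈-map⁺; ∈-++⁺ˡ; ∈-++⁺ʳ)
open import Data.List.Relation.Unary.All as All using (All; []; _∷_)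
open import Data.List.Relation.Unary.All.Properties using (¬All⇒Any¬)
open import Data.List.Relation.Unary.Any using (here; there)
open import Data.Nat using (zero; suc; _≤_; z≤n; s≤s)
open import Data.Product using (_×_; _,_; proj₁; proj₂; ∃)
open import Data.Vec using ([]; _∷_)
open import Data.Vec.Functional using (updateAt)
open import Data.Vec.Functional.Properties using (updateAt-updates; updateAt-minimal)
open import Function using (_∘_; Inverse)
open import Function.Properties.Inverse using (↔-sym; Inverse⇒Injection)
open import Function.Bundles using (Injection)
open import Induction.WellFounded using (Acc; acc)
open import Relation.Binary.PropositionalEquality using (_≡_; _≢_; refl; sym; trans; cong; subst)
open import Relation.Nullary using (¬_; Dec; yes; no; contradiction)
open import Relation.Nullary.Decidable using (_×-dec_)

subsets : ∀ n → List (Subset n)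
subsets zero    = [] ∷ []
subsets (suc n) = map (outside ∷_) (subsets n) ++ map (inside ∷_) (subsets n)

∈-subsets : ∀ {n} (p : Subset n) → p ∈ˡ subsets n
∈-subsets []            = here refl
∈-subsets (outside ∷ p) = ∈-++⁺ˡ (∈-map⁺ (outside ∷_) (∈-subsets p))
∈-subsets {suc n} (inside ∷ p) =
  ∈-++⁺ʳ (map (outside ∷_) (subsets n)) (∈-map⁺ (inside ∷_) (∈-subsets p))

2≤∣p∣⇒Nonempty : ∀ {n} (p : Subset n) → 2 ≤ ∣ p ∣ → Nonempty p
2≤∣p∣⇒Nonempty {n} p 2≤∣p∣ with nonempty? p
... | yes ne = ne
... | no empty with subst (2 ≤_) (trans (cong ∣_∣ (Empty-unique empty)) (∣⊥∣≡0 n)) 2≤∣p∣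
...   | ()

∩-singleton : ∀ {n} {p q : Subset n} {v} → v ∈ p → v ∈ q →
              (∀ x → x ∈ p → x ∈ q → x ≡ v) → p ∩ q ≡ ⁅ v ⁆
∩-singleton {p = p} {q} {v} v∈p v∈q only = ⊆-antisym
  (λ {x} x∈p∩q → let x∈p , x∈q = x∈p∩q⁻ p q x∈p∩q in
    subst (_∈ ⁅ v ⁆) (sym (only x x∈p x∈q)) (x∈⁅x⁆ v))
  (λ x∈⁅v⁆ → subst (_∈ p ∩ q) (sym (x∈⁅y⁆⇒x≡y v x∈⁅v⁆)) (x∈p∩q⁺ (v∈p , v∈q)))

Attains : ∀ {n} → (Fin n → Bool) → Bool → Subset n → Set
Attains c b p = ∃ λ v → v ∈ p × c v ≡ b

attains? : ∀ {n} (c : Fin n → Bool) b p → Dec (Attains c b p)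
attains? c b p = any? λ v → (v ∈? p) ×-dec (c v ≟ᵇ b)

¬Attains⇒≡not : ∀ {n} {c : Fin n → Bool} {b p v} →
                ¬ Attains c b p → v ∈ p → c v ≡ not b
¬Attains⇒≡not misses v∈p = ¬-not λ cv≡b → misses (_ , v∈p , cv≡b)

Attains-not : ∀ {n} {c : Fin n → Bool} {b p} →
              Attains c b p → Attains (not ∘ c) (not b) p
Attains-not (v , v∈p , cv≡b) = v , v∈p , cong not cv≡b

Bichromatic : ∀ {n} → (Fin n → Bool) → Subset n → Set
Bichromatic c p = ∀ b → Attains c b p

bichromatic : ∀ {n} {c : Fin n → Bool} {p} b →
              Attains c b p → Attains c (not b) p → Bichromatic c p
bichromatic true  t f true  = t
bichromatic true  t f false = f
bichromatic false f t true  = t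
bichromatic false f t false = f

module _ (H : Hypergraph) (size≥2 : EdgesOfSizeAtLeast H 2) where
  open Hypergraph H

  Edge-≡ : {e f : Edge} → proj₁ e ≡ proj₁ f → e ≡ f
  Edge-≡ {p , t} {.p , t′} refl = cong (p ,_) (T-irrelevant t t′)

  -- The induction runs over a list of edges, whereas `isEdge` is only a characteristic function.
  -- Filtering `subsets order` yields a list that contains every edge.
  edgesAmong : List (Subset order) → List Edge
  edgesAmong []       = []
  edgesAmong (p ∷ ps) with T? (isEdge p)
  ... | yes t = (p , t) ∷ edgesAmong ps
  ... | no  _ = edgesAmong ps

  ∈-edgesAmong : ∀ {ps} (e : Edge) → proj₁ e ∈ˡ ps → e ∈ˡ edgesAmong ps
  ∈-edgesAmong {p ∷ ps} e e∈ps with T? (isEdge p) | e∈ps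
  ... | yes _ | here e≡p   = here (Edge-≡ e≡p)
  ... | yes _ | there e∈ps′ = there (∈-edgesAmong e e∈ps′)
  ... | no ¬t | here refl  = contradiction (proj₂ e) ¬t
  ... | no _  | there e∈ps′ = ∈-edgesAmong e e∈ps′

  singletonMeet⇒Adj : ∀ {e f : Edge} {v} → proj₁ e ∩ proj₁ f ≡ ⁅ v ⁆ →
                      Graph.Adj (1-intersectionGraph H) e f
  singletonMeet⇒Adj {e} {f} {v} e∩f≡⁅v⁆ = e≢f , ∣e∩f∣≡1
    where
    ∣e∩f∣≡1 : ∣ proj₁ e ∩ proj₁ f ∣ ≡ 1
    ∣e∩f∣≡1 = trans (cong ∣_∣ e∩f≡⁅v⁆) (∣⁅x⁆∣≡1 v)

    -- If the edges coincided, their intersection would be the edge itself, which has at least two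
    -- vertices.
    e≢f : e ≢ f
    e≢f refl with subst (2 ≤_) (trans (cong ∣_∣ (sym (∩-idem (proj₁ e)))) ∣e∩f∣≡1) (size≥2 e)
    ... | s≤s ()

  module _ (κ : Edge → Bool)
           (κ-proper : ∀ e f → Graph.Adj (1-intersectionGraph H) e f → κ e ≢ κ f) where

    AttainsOpposite : (Fin order → Bool) → Edge → Set
    AttainsOpposite c e = Attains c (not (κ e)) (proj₁ e)

    flip-AttainsOpposite : ∀ {c e v} → v ∈ proj₁ e → ¬ Attains c (κ e) (proj₁ e) →
      ∀ {g} → AttainsOpposite c g → AttainsOpposite (updateAt c v not) g
    flip-AttainsOpposite {c} {e} {v} v∈e misses {g} (x , x∈g , cx≡) with x ≟ v
    ... | no x≢v = x , x∈g , trans (updateAt-minimal x v c x≢v) cx≡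
    -- Losing the witness `v` is harmless if `g` attains `not (κ g)` at some other vertex.
    ... | yes refl with attains? (updateAt c v not) (not (κ g)) (proj₁ g)
    ...   | yes attained = attained
    ...   | no lost = contradiction κg≡κe
                        (κ-proper g e (singletonMeet⇒Adj {g} {e} (∩-singleton x∈g v∈e only-v)))
      where
      -- Before the flip, `v` has the colour `not (κ g)` as the witness of `g`, and `not (κ e)` as a
      -- vertex of `e`.
      κg≡κe : κ g ≡ κ e
      κg≡κe = not-injective (trans (sym cx≡) (¬Attains⇒≡not misses v∈e))

      -- Any other common vertex has the colour `not (κ e)`, equal to `not (κ g)`, and keeps it
      -- under the flip, so `g` would still attain that colour.
      only-v : ∀ y → y ∈ proj₁ g → y ∈ proj₁ e → y ≡ v
      only-v y y∈g y∈e with y ≟ v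
      ... | yes y≡v = y≡v
      ... | no  y≢v = contradiction
        (y , y∈g , trans (updateAt-minimal y v c y≢v)
                     (trans (¬Attains⇒≡not misses y∈e) (cong not (sym κg≡κe))))
        lost

    module _ {es : List Edge} {c₀ : Fin order → Bool}
             (opposite₀ : All (AttainsOpposite c₀) es) where

      -- s contains the vertices that have not been flipped yet.
      repair : ∀ {s} → Acc _⊂_ s → (c : Fin order → Bool) →
               (∀ v → c v ≡ c₀ v → v ∈ s) → All (AttainsOpposite c) es →
               ∃ λ c′ → All (Bichromatic c′ ∘ proj₁) es
      repair {s} (acc rec) c unflipped opposite
        with All.all? (λ e → attains? c (κ e) (proj₁ e)) es
      ... | yes attained =
            c , All.zipWith (λ {e} (same , opp) → bichromatic (κ e) same opp) (attained , opposite)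
      ... | no ¬attained
        with find (¬All⇒Any¬ (λ e → attains? c (κ e) (proj₁ e)) es ¬attained)
      -- The vertex to flip is taken from `opposite₀` rather than `opposite`: its colour in `c₀` is
      -- `not (κ e)`, and so is its current one because `e` misses `κ e`. Hence it lies in `s`,
      -- which strictly shrinks.
      ...   | e , e∈es , misses with All.lookup opposite₀ e∈es
      ...     | v , v∈e , c₀v≡ =
        repair (rec (x∈p⇒p-x⊂p (unflipped v cv≡c₀v))) (updateAt c v not) unflipped′
          (All.map (λ {g} → flip-AttainsOpposite {e = e} v∈e misses {g}) opposite)
        where
        cv≡c₀v : c v ≡ c₀ v
        cv≡c₀v = trans (¬Attains⇒≡not misses v∈e) (sym c₀v≡)

        unflipped′ : ∀ w → updateAt c v not w ≡ c₀ w → w ∈ s - v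
        unflipped′ w c′w≡c₀w with w ≟ v
        ... | no w≢v = x∈p∧x≢y⇒x∈p-y
          (unflipped w (trans (sym (updateAt-minimal w v c w≢v)) c′w≡c₀w)) w≢v
        -- At the flipped vertex, agreement with `c₀` would mean `not (c w) ≡ c w`.
        ... | yes refl with c w | trans (sym (updateAt-updates w c)) (trans c′w≡c₀w (sym cv≡c₀v))
        ...   | true  | ()
        ...   | false | ()

    -- On bichromatic edges both `c` and `not ∘ c` attain every colour, so the new edge `f` alone
    -- decides between the two.
    opposite-extend : ∀ {f es c} → All (Bichromatic c ∘ proj₁) es →
                      ∃ λ c₀ → All (AttainsOpposite c₀) (f ∷ es)
    opposite-extend {f} {c = c} proper with attains? c (not (κ f)) (proj₁ f)
    ... | yes opp = c , opp ∷ All.map (λ {e} bi → bi (not (κ e))) proper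
    ... | no misses = not ∘ c , Attains-not f-attains ∷ All.map (λ {e} bi → Attains-not (bi (κ e))) proper
      where
      f-attains : Attains c (κ f) (proj₁ f)
      f-attains = let v , v∈f = 2≤∣p∣⇒Nonempty (proj₁ f) (size≥2 f) in
        v , v∈f , trans (¬Attains⇒≡not misses v∈f) (not-involutive (κ f))

    bichromaticColouring : ∀ es → ∃ λ c → All (Bichromatic c ∘ proj₁) es
    bichromaticColouring []       = (λ _ → true) , []
    bichromaticColouring (f ∷ es) =
      let c  , proper   = bichromaticColouring es
          c₀ , opposite = opposite-extend {f} proper
      -- Each new edge starts a fresh repair, with `c₀` as the reference colouring and every vertex
      -- still unflipped.
      in repair opposite (⊂-wellFounded ⊤) c₀ (λ _ _ → ∈⊤) opposite

  graph2Colourable⇒2Colourable : GraphColourable (1-intersectionGraph H) 2 → Colourable H 2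
  graph2Colourable⇒2Colourable (κ , κ-proper) = Inverse.from 2↔Bool ∘ c , proper
    where
    κ-properᵇ : ∀ e f → Graph.Adj (1-intersectionGraph H) e f →
                Inverse.to 2↔Bool (κ e) ≢ Inverse.to 2↔Bool (κ f)
    κ-properᵇ e f adj = κ-proper e f adj ∘ Injection.injective (Inverse⇒Injection 2↔Bool)

    colouring : ∃ λ c → All (Bichromatic c ∘ proj₁) (edgesAmong (subsets order))
    colouring = bichromaticColouring (Inverse.to 2↔Bool ∘ κ) κ-properᵇ (edgesAmong (subsets order))

    c : Fin order → Bool
    c = proj₁ colouring

    proper : ProperColouring H (Inverse.from 2↔Bool ∘ c)
    proper e mono
      with bi ← All.lookup (proj₂ colouring) (∈-edgesAmong e (∈-subsets (proj₁ e)))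
      with x , x∈e , cx≡true ← bi true | y , y∈e , cy≡false ← bi false
      with () ← trans (sym cx≡true) (trans
             (Injection.injective (Inverse⇒Injection (↔-sym 2↔Bool)) (mono x y x∈e y∈e)) cy≡false)

-- This serves the lower bound: with at most one colour every edge is monochromatic, so a proper
-- colouring forces the edge set to be empty. The intersection graph then has no vertices and is
-- even 0-colourable, against its chromatic number being 2.
noEdges⇒graphColourable : ∀ H {k} → ¬ Hypergraph.Edge H → GraphColourable (1-intersectionGraph H) k
noEdges⇒graphColourable H noEdge = (λ e → contradiction e noEdge) , λ e → contradiction e noEdge

theorem1p3 : (H : Hypergraph) → EdgesOfSizeAtLeast H 2 → GraphChromaticNumber (1-intersectionGraph H) 2 → ChromaticNumber H 2
theorem1p3 H size≥2 (graphColourable , graphLeast) =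
  graph2Colourable⇒2Colourable H size≥2 graphColourable , least
  where
  least : ∀ j → Colourable H j → 2 ≤ j
  least zero (c , proper) =
    graphLeast 0 (noEdges⇒graphColourable H λ e → proper e λ x → contradiction (c x) λ ())
  least (suc zero) (c , proper) = contradiction
    (graphLeast 0 (noEdges⇒graphColourable H λ e → proper e λ x y _ _ → Fin1-≡ (c x) (c y))) λ ()
    where
    Fin1-≡ : (i j : Fin 1) → i ≡ j
    Fin1-≡ zero zero = refl
  least (suc (suc j)) _ = s≤s (s≤s z≤n)
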